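{- Let $\{p_n(x)\}_{n\ge 0}$ be a recursive polynomial sequence satisfying $p_{n+2}(x)=a(x)p_{n+1}(x)+b(x)p_n(x)$ for $n\ge 0$, with initial polynomials $p_0(x),p_1(x)$ and fixed polynomials $a(x),b(x)$ (independent of $n$), and suppose it has a Riordan array representation $(g,f)$. Then $$\frac{d^\ell}{dx^\ell}p_n(1)=[t^n]\frac{g(t)f(t)^{\ell-1}}{\ell!\,(1-f(t))^{\ell+1}},\qquad \frac{d^\ell}{dx^\ell}p_n(-1)=[t^n]\frac{g(t)f(t)^{\ell-1}}{\ell!\,(1+f(t))^{\ell+1}}.$$ Particularly, $$p_n(1)=[t^n]\frac{g(t)}{1-f(t)},\quad p_n(-1)=[t^n]\frac{g(t)}{1+f(t)},\quad p_n'(1)=[t^n]\frac{g(t)f(t)}{(1-f(t))^2},\quad p_n'(-1)=-[t^n]\frac{g(t)f(t)}{(1+f(t))^2}.$$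
   Context: A Riordan array $(g,f)$, with formal power series $g(t)$, $g(0)\ne 0$, and $f(t)$, $f(0)=0$, $f'(0)\neq 0$, is the infinite lower triangular matrix with entries $d_{n,k}=[t^n]g(t)f(t)^k$, where $[t^n]$ extracts the coefficient of $t^n$. That $\{p_n(x)\}$ has the Riordan array representation $(g,f)$ means that its coefficient matrix is $(g,f)$, i.e. $p_n(x)=\sum_{k=0}^n d_{n,k}x^k$; equivalently $\sum_{n\ge 0}p_n(x)t^n=\frac{g(t)}{1-xf(t)}$. The notation $\frac{d^\ell}{dx^\ell}p_n(\pm1)$ means the $\ell$-th derivative of $p_n(x)$ with respect to $x$, evaluated at $x=\pm 1$.
   Formalization: The printed formulas fail (g=1, f=t, p_n=x^n). Proved instead: the ℓ-th derivative at ±1 is [t^n] ℓ! g f^ℓ/(1∓f)^(ℓ+1), with f^ℓ for f^(ℓ-1) and ℓ! in the numerator, and p_n'(-1)=[t^n] g f/(1+f)^2 without the minus sign. -}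

module Defs where

open import Algebra.Apartness.Bundles using (HeytingField; HeytingCommutativeRing)
open import Algebra.Bundles using (CommutativeRing)
open import Data.Fin.Base using (toℕ; zero; suc)
open import Data.List.Base using (List; []; _∷_; map)
open import Data.Nat.Base as ℕ using (ℕ; zero; suc; _∸_)
open import Data.Product.Base using (proj₁; proj₂)
import Algebra.Apartness.Properties.HeytingCommutativeRing as HeytingProperties
import Algebra.Properties.Monoid.Mult as Mult
import Algebra.Properties.Monoid.Sum as Sum
import Algebra.Properties.Ring as RingProperties
import Data.Vec.Functional as Vector
import Level
import Relation.Binary.Reasoning.Setoid as SetoidReasoning

-- x # 0# is the constructive form of x ≠ 0 in a field.
module Riordan {c ℓ₁ ℓ₂} (K : HeytingField c ℓ₁ ℓ₂) where

  open HeytingField K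
  open HeytingCommutativeRing heytingCommutativeRing using (commutativeRing)
  open CommutativeRing commutativeRing using (ring; +-monoid)
  open HeytingProperties heytingCommutativeRing
  open RingProperties ring using (-0#≈0#; -‿distribʳ-*)
  open Mult +-monoid using (_×_)
  open Sum +-monoid using (sum; sum⁺-syntax; sum-cong-≋)

  -- The list c₀ ∷ c₁ ∷ … ∷ c_d ∷ [] stands for c₀ + c₁ x + … + c_d x^d.
  -- Trailing zeros are allowed, so equality of polynomials is _≈ₚ_.
  Poly : Set c
  Poly = List Carrier

  coeff : Poly → ℕ → Carrier
  coeff []      _       = 0#
  coeff (a ∷ p) zero    = a
  coeff (a ∷ p) (suc k) = coeff p k

  infix 4 _≈ₚ_
  _≈ₚ_ : Poly → Poly → Set ℓ₁
  p ≈ₚ q = ∀ k → coeff p k ≈ coeff q k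

  infixl 6 _+ₚ_
  _+ₚ_ : Poly → Poly → Poly
  []      +ₚ q       = q
  (a ∷ p) +ₚ []      = a ∷ p
  (a ∷ p) +ₚ (b ∷ q) = a + b ∷ p +ₚ q

  infixl 7 _*ₚ_
  _*ₚ_ : Poly → Poly → Poly
  []      *ₚ q = []
  (a ∷ p) *ₚ q = map (a *_) q +ₚ (0# ∷ p *ₚ q)

  eval : Poly → Carrier → Carrier
  eval []      x = 0#
  eval (a ∷ p) x = a + x * eval p x

  -- scaleFrom m (c₀ ∷ c₁ ∷ …) = m c₀ ∷ (m + 1) c₁ ∷ …
  scaleFrom : ℕ → Poly → Poly
  scaleFrom m []      = []
  scaleFrom m (a ∷ p) = m × a ∷ scaleFrom (suc m) p

  ∂ : Poly → Poly
  ∂ []      = []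
  ∂ (a ∷ p) = scaleFrom 1 p

  ∂^ : ℕ → Poly → Poly
  ∂^ zero    p = p
  ∂^ (suc ℓ) p = ∂ (∂^ ℓ p)

  -- The coefficient extraction [tⁿ] u is the application u n.
  Series : Set c
  Series = ℕ → Carrier

  1ₛ : Series
  1ₛ zero    = 1#
  1ₛ (suc _) = 0#

  infixl 6 _+ₛ_ _-ₛ_
  infixl 7 _*ₛ_
  infixr 8 _^ₛ_
  infixr 8 _·ₛ_

  _+ₛ_ _-ₛ_ _*ₛ_ : Series → Series → Series
  (u +ₛ v) n = u n + v n
  (u -ₛ v) n = u n - v n
  (u *ₛ v) n = ∑[ i ≤ n ] (u (toℕ i) * v (n ∸ toℕ i))

  _·ₛ_ : ℕ → Series → Series
  (m ·ₛ u) n = m × u n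

  _^ₛ_ : Series → ℕ → Series
  u ^ₛ zero  = 1ₛ
  u ^ₛ suc k = u *ₛ u ^ₛ k

  private
    recip : ∀ {x} → x # 0# → Carrier
    recip x#0 = proj₁ (#⇒invertible x#0)

    recip-inverse : ∀ {x} (x#0 : x # 0#) → x * recip x#0 ≈ 1#
    recip-inverse {x} x#0 =
      trans (*-congʳ (sym (x-0≈x x))) (proj₂ (proj₂ (#⇒invertible x#0)))

  -- The coefficients of 1 / u in reverse order, from [tⁿ] down to [t⁰],
  -- found by solving u · v = 1 degree by degree.
  invPrefix : (u : Series) → u 0 # 0# → ∀ n → Vector.Vector Carrier (suc n)
  invPrefix u u₀#0 zero    = Vector.replicate 1 (recip u₀#0)
  invPrefix u u₀#0 (suc n) =
    (- (recip u₀#0 * ∑[ i ≤ n ] (u (suc (toℕ i)) * invPrefix u u₀#0 n i)))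
    Vector.∷ invPrefix u u₀#0 n

  inv : (u : Series) → u 0 # 0# → Series
  inv u u₀#0 n = Vector.head (invPrefix u u₀#0 n)

  infixl 7 _/ₛ_[_]
  _/ₛ_[_] : (u v : Series) → v 0 # 0# → Series
  u /ₛ v [ v₀#0 ] = u *ₛ inv v v₀#0

  private
    invPrefix-inv : ∀ u (u₀#0 : u 0 # 0#) n i →
                    invPrefix u u₀#0 n i ≈ inv u u₀#0 (n ∸ toℕ i)
    invPrefix-inv u u₀#0 zero    zero    = refl
    invPrefix-inv u u₀#0 (suc n) zero    = refl
    invPrefix-inv u u₀#0 (suc n) (suc i) = invPrefix-inv u u₀#0 n i

  inv-inverse : ∀ u (u₀#0 : u 0 # 0#) n → (u *ₛ inv u u₀#0) n ≈ 1ₛ n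
  inv-inverse u u₀#0 zero    = trans (+-identityʳ _) (recip-inverse u₀#0)
  inv-inverse u u₀#0 (suc n) = begin
    u 0 * - (r * s) + s′   ≈⟨ +-congʳ (-‿distribʳ-* (u 0) (r * s)) ⟨
    - (u 0 * (r * s)) + s′ ≈⟨ +-congʳ (-‿cong (*-assoc (u 0) r s)) ⟨
    - (u 0 * r * s) + s′   ≈⟨ +-congʳ (-‿cong (*-congʳ (recip-inverse u₀#0))) ⟩
    - (1# * s) + s′        ≈⟨ +-congʳ (-‿cong (*-identityˡ s)) ⟩
    - s + s′               ≈⟨ +-congˡ (sum-cong-≋ (λ i → *-congˡ {x = u (suc (toℕ i))} (invPrefix-inv u u₀#0 n i))) ⟨
    - s + s                ≈⟨ -‿inverseˡ s ⟩
    0#                     ∎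
    where
    open SetoidReasoning setoid
    r  = recip u₀#0
    s  = ∑[ i ≤ n ] (u (suc (toℕ i)) * invPrefix u u₀#0 n i)
    s′ = ∑[ i ≤ n ] (u (suc (toℕ i)) * inv u u₀#0 (n ∸ toℕ i))

  record IsRiordanPair (g f : Series) : Set (ℓ₁ Level.⊔ ℓ₂) where
    field
      g₀#0 : g 0 # 0#
      f₀≈0 : f 0 ≈ 0#
      f₁#0 : f 1 # 0#

  riordan : (g f : Series) → ℕ → ℕ → Carrier
  riordan g f n k = (g *ₛ f ^ₛ k) n

  -- The condition runs over all k, so for k > n it says that p n has no
  -- coefficient beyond xⁿ (the array is lower triangular as f 0 ≈ 0).
  HasRiordanRepresentation : (ℕ → Poly) → Series → Series → Set ℓ₁
  HasRiordanRepresentation p g f = ∀ n k → coeff (p n) k ≈ riordan g f n k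

  ^ₛ-#0 : ∀ u k → u 0 # 0# → (u ^ₛ k) 0 # 0#
  ^ₛ-#0 u zero    _    = 1#0
  ^ₛ-#0 u (suc k) u₀#0 =
    #-congʳ (sym (+-identityʳ _)) (x#0y#0→xy#0 u₀#0 (^ₛ-#0 u k u₀#0))

  module _ {g f} (R : IsRiordanPair g f) where
    open IsRiordanPair R

    1-f#0 : (1ₛ -ₛ f) 0 # 0#
    1-f#0 = #-congʳ (sym (trans (+-congˡ (-‿cong f₀≈0)) (x-0≈x 1#))) 1#0

    1+f#0 : (1ₛ +ₛ f) 0 # 0#
    1+f#0 = #-congʳ (sym (trans (+-congˡ f₀≈0) (+-identityʳ 1#))) 1#0

    [1-f]^k#0 : ∀ k → ((1ₛ -ₛ f) ^ₛ k) 0 # 0#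
    [1-f]^k#0 k = ^ₛ-#0 (1ₛ -ₛ f) k 1-f#0

    [1+f]^k#0 : ∀ k → ((1ₛ +ₛ f) ^ₛ k) 0 # 0#
    [1+f]^k#0 k = ^ₛ-#0 (1ₛ +ₛ f) k 1+f#0

{-# OPTIONS --safe #-}

-- The representation says p₀ + p₁ t + … = g + x f (p₀ + p₁ t + …).
-- Differentiating ℓ + 1 times in x, the sums S_ℓ = Σₙ p_n^(ℓ)(x) tⁿ satisfy
-- (1 - x f) S₀ = g and (1 - x f) S_{ℓ+1} = (ℓ + 1) f S_ℓ, so that
-- (1 - x f)^{ℓ+1} S_ℓ = ℓ! g f^ℓ.

module Submission where

open import Defs
open import Algebra.Apartness.Bundles using (HeytingField; HeytingCommutativeRing)
open import Algebra.Bundles using (CommutativeRing; CommutativeMonoid)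
open import Data.List.Base using ([]; _∷_; map)
open import Data.Nat.Base using (ℕ; zero; suc; _!)
open import Data.Product.Base using (_×_; _,_)
open import Function.Base using (_∘_)
import Algebra.Construct.Pointwise as Pointwise
import Algebra.Properties.CommutativeMonoid.Mult as CommutativeMonoidMult
import Algebra.Properties.CommutativeSemigroup as CommutativeSemigroupProperties
import Algebra.Properties.Ring as RingProperties
import Algebra.Properties.Semiring.Mult as SemiringMult
import Data.Nat as ℕ
import Data.Nat.Properties as ℕ
import Level
import Relation.Binary.Reasoning.Setoid as SetoidReasoning

module RiordanProperties {c ℓ₁ ℓ₂} (K : HeytingField c ℓ₁ ℓ₂) where

  open HeytingField K
  open HeytingCommutativeRing heytingCommutativeRing using (commutativeRing)
  open CommutativeRing commutativeRing
    using (ring; semiring; +-commutativeMonoid; +-commutativeSemigroup; *-commutativeSemigroup)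
  open Riordan K
  open SemiringMult semiring
    using (×-congʳ; ×-congˡ; ×-homo-1; ×-homo-+; ×-assocˡ; ×-comm-*; ×-assoc-*)
    renaming (_×_ to _⨯_)
  open CommutativeMonoidMult +-commutativeMonoid using (×-distrib-+)
  open RingProperties ring using (+-cancelʳ; -1*x≈-x)
  module + = CommutativeSemigroupProperties +-commutativeSemigroup
  module * = CommutativeSemigroupProperties *-commutativeSemigroup
  open SetoidReasoning setoid

  -- The ring of formal power series

  infix 4 _≈ₛ_
  _≈ₛ_ : Series → Series → Set ℓ₁
  u ≈ₛ v = ∀ n → u n ≈ v n

  infixr 8 _∙ₛ_
  -- Scaling by a field element, unlike the natural multiples `_·ₛ_`. It appears when a product is
  -- shifted by one degree, and in the series `x ∙ₛ f`.
  _∙ₛ_ : Carrier → Series → Series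
  (a ∙ₛ u) n = a * u n

  -- Below, (u *ₛ v) (suc n) reduces to u 0 * v (suc n) + (u ∘ suc *ₛ v) n.

  *ₛ-cong : ∀ {u u′ v v′} → u ≈ₛ u′ → v ≈ₛ v′ → u *ₛ v ≈ₛ u′ *ₛ v′
  *ₛ-cong u≈u′ v≈v′ zero    = +-congʳ (*-cong (u≈u′ 0) (v≈v′ 0))
  *ₛ-cong u≈u′ v≈v′ (suc n) =
    +-cong (*-cong (u≈u′ 0) (v≈v′ (suc n))) (*ₛ-cong (u≈u′ ∘ suc) v≈v′ n)

  *ₛ-zeroˡ : ∀ {u} v → (∀ n → u n ≈ 0#) → ∀ n → (u *ₛ v) n ≈ 0#
  *ₛ-zeroˡ v u≈0 zero    =
    trans (+-identityʳ _) (trans (*-congʳ (u≈0 0)) (zeroˡ _))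
  *ₛ-zeroˡ v u≈0 (suc n) =
    trans (+-cong (trans (*-congʳ (u≈0 0)) (zeroˡ _)) (*ₛ-zeroˡ v (u≈0 ∘ suc) n))
          (+-identityˡ 0#)

  *ₛ-identityˡ : ∀ u → 1ₛ *ₛ u ≈ₛ u
  *ₛ-identityˡ u zero    = trans (+-identityʳ _) (*-identityˡ _)
  *ₛ-identityˡ u (suc n) =
    trans (+-cong (*-identityˡ _) (*ₛ-zeroˡ u (λ _ → refl) n)) (+-identityʳ _)

  *ₛ-distribʳ : ∀ u v w → (v +ₛ w) *ₛ u ≈ₛ v *ₛ u +ₛ w *ₛ u
  *ₛ-distribʳ u v w zero    = begin
    (v 0 + w 0) * u 0 + 0#                ≈⟨ +-identityʳ _ ⟩
    (v 0 + w 0) * u 0                     ≈⟨ distribʳ _ _ _ ⟩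
    v 0 * u 0 + w 0 * u 0                 ≈⟨ +-cong (+-identityʳ _) (+-identityʳ _) ⟨
    (v 0 * u 0 + 0#) + (w 0 * u 0 + 0#)   ∎
  *ₛ-distribʳ u v w (suc n) =
    trans (+-cong (distribʳ _ _ _) (*ₛ-distribʳ u (v ∘ suc) (w ∘ suc) n))
          (+.interchange _ _ _ _)

  ∙ₛ-assoc-*ₛ : ∀ a u v → (a ∙ₛ u) *ₛ v ≈ₛ a ∙ₛ (u *ₛ v)
  ∙ₛ-assoc-*ₛ a u v zero    = begin
    a * u 0 * v 0 + 0#     ≈⟨ +-identityʳ _ ⟩
    a * u 0 * v 0          ≈⟨ *-assoc _ _ _ ⟩
    a * (u 0 * v 0)        ≈⟨ *-congˡ (+-identityʳ _) ⟨
    a * (u 0 * v 0 + 0#)   ∎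
  ∙ₛ-assoc-*ₛ a u v (suc n) =
    trans (+-cong (*-assoc _ _ _) (∙ₛ-assoc-*ₛ a (u ∘ suc) v n)) (sym (distribˡ _ _ _))

  ·ₛ-comm-*ₛ : ∀ m u v → u *ₛ m ·ₛ v ≈ₛ m ·ₛ (u *ₛ v)
  ·ₛ-comm-*ₛ m u v zero    = begin
    u 0 * (m ⨯ v 0) + 0#   ≈⟨ +-identityʳ _ ⟩
    u 0 * (m ⨯ v 0)        ≈⟨ ×-comm-* m _ _ ⟩
    m ⨯ (u 0 * v 0)        ≈⟨ ×-congʳ m (+-identityʳ _) ⟨
    m ⨯ (u 0 * v 0 + 0#)   ∎
  ·ₛ-comm-*ₛ m u v (suc n) =
    trans (+-cong (×-comm-* m _ _) (·ₛ-comm-*ₛ m (u ∘ suc) v n)) (sym (×-distrib-+ _ _ m))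

  *ₛ-assoc : ∀ u v w → (u *ₛ v) *ₛ w ≈ₛ u *ₛ (v *ₛ w)
  *ₛ-assoc u v w zero    = begin
    (u 0 * v 0 + 0#) * w 0 + 0#   ≈⟨ +-congʳ (*-congʳ (+-identityʳ _)) ⟩
    u 0 * v 0 * w 0 + 0#          ≈⟨ +-congʳ (*-assoc _ _ _) ⟩
    u 0 * (v 0 * w 0) + 0#        ≈⟨ +-congʳ (*-congˡ (+-identityʳ _)) ⟨
    u 0 * (v 0 * w 0 + 0#) + 0#   ∎
  *ₛ-assoc u v w (suc n) = begin
    -- The shifted series `(u *ₛ v) ∘ suc` reduces to `u 0 ∙ₛ v′ +ₛ u′ *ₛ v`.
    (u 0 * v 0 + 0#) * w (suc n) + ((u 0 ∙ₛ v′ +ₛ u′ *ₛ v) *ₛ w) n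
      ≈⟨ +-cong (*-congʳ (+-identityʳ _)) (*ₛ-distribʳ w (u 0 ∙ₛ v′) (u′ *ₛ v) n) ⟩
    u 0 * v 0 * w (suc n) + (((u 0 ∙ₛ v′) *ₛ w) n + ((u′ *ₛ v) *ₛ w) n)
      ≈⟨ +-cong (*-assoc _ _ _) (+-cong (∙ₛ-assoc-*ₛ (u 0) v′ w n) (*ₛ-assoc u′ v w n)) ⟩
    u 0 * (v 0 * w (suc n)) + (u 0 * (v′ *ₛ w) n + (u′ *ₛ (v *ₛ w)) n)
      ≈⟨ +-assoc _ _ _ ⟨
    u 0 * (v 0 * w (suc n)) + u 0 * (v′ *ₛ w) n + (u′ *ₛ (v *ₛ w)) n
      ≈⟨ +-congʳ (distribˡ _ _ _) ⟨
    u 0 * (v 0 * w (suc n) + (v′ *ₛ w) n) + (u′ *ₛ (v *ₛ w)) n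
      ∎
    where
    u′ = u ∘ suc
    v′ = v ∘ suc

  -- Products unfold along the left factor only, so each factor is peeled in turn, with swaps at
  -- degrees n + 1 and n in between. This is why the induction needs both 0 and 1 as base cases.
  *ₛ-comm : ∀ u v → u *ₛ v ≈ₛ v *ₛ u
  *ₛ-comm u v zero          = +-congʳ (*-comm _ _)
  *ₛ-comm u v (suc zero)    = begin
    u 0 * v 1 + (u 1 * v 0 + 0#)   ≈⟨ +.x∙yz≈y∙xz _ _ _ ⟩
    u 1 * v 0 + (u 0 * v 1 + 0#)   ≈⟨ +-cong (*-comm _ _) (+-congʳ (*-comm _ _)) ⟩
    v 0 * u 1 + (v 1 * u 0 + 0#)   ∎
  *ₛ-comm u v (suc (suc n)) = begin
    u 0 * v (2 ℕ.+ n) + (u′ *ₛ v) (suc n)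
      ≈⟨ +-congˡ (*ₛ-comm u′ v (suc n)) ⟩
    u 0 * v (2 ℕ.+ n) + (v 0 * u (2 ℕ.+ n) + (v′ *ₛ u′) n)
      ≈⟨ +.x∙yz≈y∙xz _ _ _ ⟩
    v 0 * u (2 ℕ.+ n) + (u 0 * v (2 ℕ.+ n) + (v′ *ₛ u′) n)
      ≈⟨ +-congˡ (+-congˡ (*ₛ-comm v′ u′ n)) ⟩
    v 0 * u (2 ℕ.+ n) + (u *ₛ v′) (suc n)
      ≈⟨ +-congˡ (*ₛ-comm u v′ (suc n)) ⟩
    v 0 * u (2 ℕ.+ n) + (v′ *ₛ u) (suc n)
      ∎
    where
    u′ = u ∘ suc
    v′ = v ∘ suc

  *ₛ-commutativeMonoid : CommutativeMonoid c ℓ₁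
  *ₛ-commutativeMonoid = record
    { Carrier             = Series
    ; _≈_                 = _≈ₛ_
    ; _∙_                 = _*ₛ_
    ; ε                   = 1ₛ
    ; isCommutativeMonoid = record
      { isMonoid = record
        { isSemigroup = record
          { isMagma = record
            { isEquivalence = Pointwise.isEquivalence ℕ isEquivalence
            ; ∙-cong        = *ₛ-cong
            }
          ; assoc = *ₛ-assoc
          }
        ; identity = *ₛ-identityˡ , λ u n → trans (*ₛ-comm u 1ₛ n) (*ₛ-identityˡ u n)
        }
      ; comm = *ₛ-comm
      }
    }

  module S where
    open CommutativeMonoid *ₛ-commutativeMonoid public
    open CommutativeSemigroupProperties commutativeSemigroup public

  -- Insert v · (1 / v) = 1 next to w and regroup. Every quotient formula thereby reduces to an
  -- identity with the denominator cleared.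
  /ₛ-unique : ∀ u v w (v₀#0 : v 0 # 0#) → v *ₛ w ≈ₛ u → w ≈ₛ u /ₛ v [ v₀#0 ]
  /ₛ-unique u v w v₀#0 vw≈u n = begin
    w n                          ≈⟨ S.identityʳ w n ⟨
    (w *ₛ 1ₛ) n                  ≈⟨ S.∙-congˡ {w} (inv-inverse v v₀#0) n ⟨
    (w *ₛ (v *ₛ inv v v₀#0)) n   ≈⟨ S.x∙yz≈yx∙z w v (inv v v₀#0) n ⟩
    ((v *ₛ w) *ₛ inv v v₀#0) n   ≈⟨ S.∙-congʳ {inv v v₀#0} vw≈u n ⟩
    (u *ₛ inv v v₀#0) n          ∎

  -- Evaluation and differentiation of polynomials

  coeff-+ₚ : ∀ p q k → coeff (p +ₚ q) k ≈ coeff p k + coeff q k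
  coeff-+ₚ []      q       k       = sym (+-identityˡ _)
  coeff-+ₚ (a ∷ p) []      k       = sym (+-identityʳ _)
  coeff-+ₚ (a ∷ p) (b ∷ q) zero    = refl
  coeff-+ₚ (a ∷ p) (b ∷ q) (suc k) = coeff-+ₚ p q k

  coeff-map-* : ∀ a p k → coeff (map (a *_) p) k ≈ a * coeff p k
  coeff-map-* a []      k       = sym (zeroʳ a)
  coeff-map-* a (b ∷ p) zero    = refl
  coeff-map-* a (b ∷ p) (suc k) = coeff-map-* a p k

  eval-+ₚ : ∀ x p q → eval (p +ₚ q) x ≈ eval p x + eval q x
  eval-+ₚ x []      q       = sym (+-identityˡ _)
  eval-+ₚ x (a ∷ p) []      = sym (+-identityʳ _)
  eval-+ₚ x (a ∷ p) (b ∷ q) = begin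
    a + b + x * eval (p +ₚ q) x               ≈⟨ +-congˡ (*-congˡ (eval-+ₚ x p q)) ⟩
    a + b + x * (eval p x + eval q x)         ≈⟨ +-congˡ (distribˡ _ _ _) ⟩
    a + b + (x * eval p x + x * eval q x)     ≈⟨ +.interchange _ _ _ _ ⟩
    (a + x * eval p x) + (b + x * eval q x)   ∎

  eval-map-* : ∀ x a p → eval (map (a *_) p) x ≈ a * eval p x
  eval-map-* x a []      = sym (zeroʳ a)
  eval-map-* x a (b ∷ p) = begin
    a * b + x * eval (map (a *_) p) x   ≈⟨ +-congˡ (*-congˡ (eval-map-* x a p)) ⟩
    a * b + x * (a * eval p x)          ≈⟨ +-congˡ (*.x∙yz≈y∙xz _ _ _) ⟩
    a * b + a * (x * eval p x)          ≈⟨ distribˡ _ _ _ ⟨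
    a * (b + x * eval p x)              ∎

  eval-zero : ∀ x p → (∀ k → coeff p k ≈ 0#) → eval p x ≈ 0#
  eval-zero x []      p≈0 = refl
  eval-zero x (a ∷ p) p≈0 =
    trans (+-cong (p≈0 0) (trans (*-congˡ (eval-zero x p (p≈0 ∘ suc))) (zeroʳ x)))
          (+-identityʳ 0#)

  -- Equal polynomials may be lists of different lengths; once one list ends, the rest of the other
  -- has only zero coefficients and `eval-zero` applies.
  eval-cong : ∀ x {p q} → p ≈ₚ q → eval p x ≈ eval q x
  eval-cong x {[]}    {q}     p≈q = sym (eval-zero x q (sym ∘ p≈q))
  eval-cong x {a ∷ p} {[]}    p≈q = eval-zero x (a ∷ p) p≈q
  eval-cong x {a ∷ p} {b ∷ q} p≈q =
    +-cong (p≈q 0) (*-congˡ (eval-cong x {p} {q} (p≈q ∘ suc)))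

  ×-zeroʳ : ∀ m → m ⨯ 0# ≈ 0#
  ×-zeroʳ zero    = refl
  ×-zeroʳ (suc m) = trans (+-identityˡ _) (×-zeroʳ m)

  coeff-scaleFrom : ∀ m p k → coeff (scaleFrom m p) k ≈ (k ℕ.+ m) ⨯ coeff p k
  coeff-scaleFrom m []      k       = sym (×-zeroʳ (k ℕ.+ m))
  coeff-scaleFrom m (a ∷ p) zero    = refl
  coeff-scaleFrom m (a ∷ p) (suc k) =
    trans (coeff-scaleFrom (suc m) p k) (×-congˡ (ℕ.+-suc k m))

  coeff-scaleFrom-1 : ∀ p k → coeff (scaleFrom 1 p) k ≈ suc k ⨯ coeff p k
  coeff-scaleFrom-1 p k = trans (coeff-scaleFrom 1 p k) (×-congˡ (ℕ.+-comm k 1))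

  coeff-∂ : ∀ p k → coeff (∂ p) k ≈ suc k ⨯ coeff p (suc k)
  coeff-∂ []      k = sym (×-zeroʳ (suc k))
  coeff-∂ (a ∷ p) k = coeff-scaleFrom-1 p k

  -- `0# ∷ ∂ p` is the Euler operator x d/dx applied to p, which scales each monomial by its degree.
  coeff-0∷∂ : ∀ p k → coeff (0# ∷ ∂ p) k ≈ k ⨯ coeff p k
  coeff-0∷∂ p zero    = refl
  coeff-0∷∂ p (suc k) = coeff-∂ p k

  ×-leftComm : ∀ m n x → m ⨯ (n ⨯ x) ≈ n ⨯ (m ⨯ x)
  ×-leftComm m n x = begin
    m ⨯ (n ⨯ x)     ≈⟨ ×-assocˡ x m n ⟩
    (m ℕ.* n) ⨯ x   ≈⟨ ×-congˡ (ℕ.*-comm m n) ⟩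
    (n ℕ.* m) ⨯ x   ≈⟨ ×-assocˡ x n m ⟨
    n ⨯ (m ⨯ x)     ∎

  -- The constant a is killed. A coefficient c of p at degree k + ℓ sits at degree k + ℓ + 1 in x p,
  -- so the two derivatives carry (k + ℓ + 1)!/k! · c and (k + ℓ)!/k! · c. Induction on ℓ obtains
  -- their ratio without division.
  coeff-∂^-∷ : ∀ ℓ a p k →
               coeff (∂^ (suc ℓ) (a ∷ p)) k ≈ (suc ℓ ℕ.+ k) ⨯ coeff (∂^ ℓ p) k
  coeff-∂^-∷ zero    a p k = coeff-scaleFrom-1 p k
  coeff-∂^-∷ (suc ℓ) a p k = begin
    coeff (∂ (∂^ (suc ℓ) (a ∷ p))) k
      ≈⟨ coeff-∂ (∂^ (suc ℓ) (a ∷ p)) k ⟩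
    suc k ⨯ coeff (∂^ (suc ℓ) (a ∷ p)) (suc k)
      ≈⟨ ×-congʳ (suc k) (coeff-∂^-∷ ℓ a p (suc k)) ⟩
    suc k ⨯ ((suc ℓ ℕ.+ suc k) ⨯ coeff (∂^ ℓ p) (suc k))
      ≈⟨ ×-leftComm (suc k) (suc ℓ ℕ.+ suc k) _ ⟩
    (suc ℓ ℕ.+ suc k) ⨯ (suc k ⨯ coeff (∂^ ℓ p) (suc k))
      ≈⟨ ×-congʳ (suc ℓ ℕ.+ suc k) (coeff-∂ (∂^ ℓ p) k) ⟨
    (suc ℓ ℕ.+ suc k) ⨯ coeff (∂^ (suc ℓ) p) k
      ≈⟨ ×-congˡ (ℕ.+-suc (suc ℓ) k) ⟩
    (suc (suc ℓ) ℕ.+ k) ⨯ coeff (∂^ (suc ℓ) p) k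
      ∎

  -- The Leibniz rule for the product of x and p.
  eval-∂^-∷ : ∀ x ℓ a p → eval (∂^ (suc ℓ) (a ∷ p)) x
                        ≈ suc ℓ ⨯ eval (∂^ ℓ p) x + x * eval (∂^ (suc ℓ) p) x
  eval-∂^-∷ x ℓ a p = begin
    eval (∂^ (suc ℓ) (a ∷ p)) x
      ≈⟨ eval-cong x {∂^ (suc ℓ) (a ∷ p)} {map (m *_) q +ₚ (0# ∷ ∂ q)} leibniz ⟩
    eval (map (m *_) q +ₚ (0# ∷ ∂ q)) x
      ≈⟨ eval-+ₚ x (map (m *_) q) (0# ∷ ∂ q) ⟩
    eval (map (m *_) q) x + (0# + x * eval (∂ q) x)
      ≈⟨ +-cong (trans (eval-map-* x m q) (m*≈ _)) (+-identityˡ _) ⟩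
    suc ℓ ⨯ eval q x + x * eval (∂ q) x
      ∎
    where
    q = ∂^ ℓ p
    -- The natural number ℓ + 1 as a field element, since `map (m *_)` scales by field elements.
    m = suc ℓ ⨯ 1#

    m*≈ : ∀ y → m * y ≈ suc ℓ ⨯ y
    m*≈ y = trans (×-assoc-* (suc ℓ) 1# y) (×-congʳ (suc ℓ) (*-identityˡ y))

    leibniz : ∂^ (suc ℓ) (a ∷ p) ≈ₚ map (m *_) q +ₚ (0# ∷ ∂ q)
    leibniz k = begin
      coeff (∂^ (suc ℓ) (a ∷ p)) k                      ≈⟨ coeff-∂^-∷ ℓ a p k ⟩
      -- The multiplier splits into ℓ + 1, giving the first Leibniz term, and k, which is the Euler
      -- operator on q.
      (suc ℓ ℕ.+ k) ⨯ coeff q k                         ≈⟨ ×-homo-+ (coeff q k) (suc ℓ) k ⟩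
      suc ℓ ⨯ coeff q k + k ⨯ coeff q k                 ≈⟨ +-cong (m*≈ _) (coeff-0∷∂ q k) ⟨
      m * coeff q k + coeff (0# ∷ ∂ q) k                ≈⟨ +-congʳ (coeff-map-* m q k) ⟨
      coeff (map (m *_) q) k + coeff (0# ∷ ∂ q) k       ≈⟨ coeff-+ₚ (map (m *_) q) (0# ∷ ∂ q) k ⟨
      coeff (map (m *_) q +ₚ (0# ∷ ∂ q)) k              ∎

  -- Linear functionals on polynomials

  record IsLinear (φ : Poly → Carrier) : Set (c Level.⊔ ℓ₁) where
    field
      cong  : ∀ {p q} → p ≈ₚ q → φ p ≈ φ q
      homo  : ∀ p q → φ (p +ₚ q) ≈ φ p + φ q
      scale : ∀ a p → φ (map (a *_) p) ≈ a * φ p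

  coeff-isLinear : ∀ k → IsLinear (λ p → coeff p k)
  coeff-isLinear k = record
    { cong  = λ p≈q → p≈q k
    ; homo  = λ p q → coeff-+ₚ p q k
    ; scale = λ a p → coeff-map-* a p k
    }

  eval-isLinear : ∀ x → IsLinear (λ p → eval p x)
  eval-isLinear x = record
    { cong  = λ {p} {q} → eval-cong x {p} {q}
    ; homo  = eval-+ₚ x
    ; scale = eval-map-* x
    }

  ∂-cong : ∀ {p q} → p ≈ₚ q → ∂ p ≈ₚ ∂ q
  ∂-cong {p} {q} p≈q k =
    trans (coeff-∂ p k) (trans (×-congʳ (suc k) (p≈q (suc k))) (sym (coeff-∂ q k)))

  ∂-+ₚ : ∀ p q → ∂ (p +ₚ q) ≈ₚ ∂ p +ₚ ∂ q
  ∂-+ₚ p q k = begin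
    coeff (∂ (p +ₚ q)) k                                    ≈⟨ coeff-∂ (p +ₚ q) k ⟩
    suc k ⨯ coeff (p +ₚ q) (suc k)                          ≈⟨ ×-congʳ (suc k) (coeff-+ₚ p q (suc k)) ⟩
    suc k ⨯ (coeff p (suc k) + coeff q (suc k))             ≈⟨ ×-distrib-+ _ _ (suc k) ⟩
    suc k ⨯ coeff p (suc k) + suc k ⨯ coeff q (suc k)       ≈⟨ +-cong (coeff-∂ p k) (coeff-∂ q k) ⟨
    coeff (∂ p) k + coeff (∂ q) k                           ≈⟨ coeff-+ₚ (∂ p) (∂ q) k ⟨
    coeff (∂ p +ₚ ∂ q) k                                    ∎

  ∂-map-* : ∀ a p → ∂ (map (a *_) p) ≈ₚ map (a *_) (∂ p)
  ∂-map-* a p k = begin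
    coeff (∂ (map (a *_) p)) k             ≈⟨ coeff-∂ (map (a *_) p) k ⟩
    suc k ⨯ coeff (map (a *_) p) (suc k)   ≈⟨ ×-congʳ (suc k) (coeff-map-* a p (suc k)) ⟩
    suc k ⨯ (a * coeff p (suc k))          ≈⟨ ×-comm-* (suc k) a _ ⟨
    a * (suc k ⨯ coeff p (suc k))          ≈⟨ *-congˡ (coeff-∂ p k) ⟨
    a * coeff (∂ p) k                      ≈⟨ coeff-map-* a (∂ p) k ⟨
    coeff (map (a *_) (∂ p)) k             ∎

  ∘∂-isLinear : ∀ {φ} → IsLinear φ → IsLinear (φ ∘ ∂)
  ∘∂-isLinear L = record
    { cong  = λ {p} {q} p≈q → cong {∂ p} {∂ q} (∂-cong {p} {q} p≈q)
    ; homo  = λ p q → trans (cong {∂ (p +ₚ q)} {∂ p +ₚ ∂ q} (∂-+ₚ p q)) (homo (∂ p) (∂ q))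
    ; scale = λ a p →
        trans (cong {∂ (map (a *_) p)} {map (a *_) (∂ p)} (∂-map-* a p)) (scale a (∂ p))
    }
    where open IsLinear L

  ∘∂^-isLinear : ∀ {φ} → IsLinear φ → ∀ ℓ → IsLinear (φ ∘ ∂^ ℓ)
  ∘∂^-isLinear L zero    = L
  -- `∂^` adds its new derivative outermost, so `φ ∘ ∂^ (suc ℓ)` is `(φ ∘ ∂) ∘ ∂^ ℓ` and the
  -- induction changes the functional.
  ∘∂^-isLinear L (suc ℓ) = ∘∂^-isLinear (∘∂-isLinear L) ℓ

  -- The Cauchy product of u with the series Σₙ p n tⁿ over the polynomials.
  infixl 7 _⋆_
  _⋆_ : Series → (ℕ → Poly) → ℕ → Poly
  (u ⋆ p) zero    = map (u 0 *_) (p 0)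
  (u ⋆ p) (suc n) = map (u 0 *_) (p (suc n)) +ₚ (u ∘ suc ⋆ p) n

  -- A Cauchy product is a finite linear combination of the p i. The lemma serves two functionals: a
  -- coefficient, to read off columns of the array, and an evaluated derivative, to form the sums
  -- S_ℓ.
  linear-⋆ : ∀ {φ} → IsLinear φ → ∀ u p n → φ ((u ⋆ p) n) ≈ (u *ₛ φ ∘ p) n
  linear-⋆ L u p zero    = trans (IsLinear.scale L (u 0) (p 0)) (sym (+-identityʳ _))
  linear-⋆ L u p (suc n) =
    trans (IsLinear.homo L (map (u 0 *_) (p (suc n))) ((u ∘ suc ⋆ p) n))
          (+-cong (IsLinear.scale L (u 0) (p (suc n))) (linear-⋆ L (u ∘ suc) p n))

  -- Derivatives of polynomials with a Riordan representation

  module Derivatives (g f : Series) (p : ℕ → Poly) (p≈gf : HasRiordanRepresentation p g f) where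

    -- Column 0 of the array is g, and column k + 1 is f times column k. Consing `g n` encodes g n +
    -- x · (...), so this is the equation S₀ = g + x f S₀ with x as the polynomial variable.
    riordan-∷ : ∀ n → p n ≈ₚ g n ∷ (f ⋆ p) n
    riordan-∷ n zero    = trans (p≈gf n 0) (S.identityʳ g n)
    riordan-∷ n (suc k) = begin
      coeff (p n) (suc k)                    ≈⟨ p≈gf n (suc k) ⟩
      (g *ₛ (f *ₛ f ^ₛ k)) n                 ≈⟨ S.x∙yz≈y∙xz g f (f ^ₛ k) n ⟩
      (f *ₛ (g *ₛ f ^ₛ k)) n                 ≈⟨ S.∙-congˡ {f} (λ i → p≈gf i k) n ⟨
      (f *ₛ (λ i → coeff (p i) k)) n         ≈⟨ linear-⋆ (coeff-isLinear k) f p n ⟨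
      coeff ((f ⋆ p) n) k                    ∎

    -- The series S_ℓ at the point x, with n as the exponent of t.
    D : Carrier → ℕ → Series
    D x ℓ n = eval (∂^ ℓ (p n)) x

    D-isLinear : ∀ x ℓ → IsLinear (λ q → eval (∂^ ℓ q) x)
    D-isLinear x = ∘∂^-isLinear (eval-isLinear x)

    D-zero : ∀ x n → D x 0 n ≈ g n + x * (f *ₛ D x 0) n
    D-zero x n = trans (eval-cong x {p n} {g n ∷ (f ⋆ p) n} (riordan-∷ n))
                       (+-congˡ (*-congˡ (linear-⋆ (D-isLinear x 0) f p n)))

    -- Differentiate `riordan-∷` ℓ + 1 times: g does not depend on x and drops out, and the Leibniz
    -- rule for the factor x leaves two terms.
    D-suc : ∀ x ℓ n → D x (suc ℓ) n ≈ suc ℓ ⨯ (f *ₛ D x ℓ) n + x * (f *ₛ D x (suc ℓ)) n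
    D-suc x ℓ n = begin
      eval (∂^ (suc ℓ) (p n)) x
        ≈⟨ IsLinear.cong (D-isLinear x (suc ℓ)) {p n} {g n ∷ (f ⋆ p) n} (riordan-∷ n) ⟩
      eval (∂^ (suc ℓ) (g n ∷ (f ⋆ p) n)) x
        ≈⟨ eval-∂^-∷ x ℓ (g n) ((f ⋆ p) n) ⟩
      suc ℓ ⨯ eval (∂^ ℓ ((f ⋆ p) n)) x + x * eval (∂^ (suc ℓ) ((f ⋆ p) n)) x
        ≈⟨ +-cong (×-congʳ (suc ℓ) (linear-⋆ (D-isLinear x ℓ) f p n))
                  (*-congˡ (linear-⋆ (D-isLinear x (suc ℓ)) f p n)) ⟩
      suc ℓ ⨯ (f *ₛ D x ℓ) n + x * (f *ₛ D x (suc ℓ)) n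
        ∎

    -- h plays the role of 1 - x f. The additive condition lets h be literally `1ₛ -ₛ f` at x = 1
    -- and `1ₛ +ₛ f` at x = -1.
    module Resolvent (x : Carrier) (h : Series) (h+xf≈1 : h +ₛ x ∙ₛ f ≈ₛ 1ₛ) where

      -- Both h u + x f u and v + x f u equal u; cancel x f u.
      solve-h : ∀ {u v} → (∀ n → u n ≈ v n + x * (f *ₛ u) n) → h *ₛ u ≈ₛ v
      solve-h {u} {v} u≈ n = +-cancelʳ (x * (f *ₛ u) n) _ _ (begin
        (h *ₛ u) n + x * (f *ₛ u) n        ≈⟨ +-congˡ (∙ₛ-assoc-*ₛ x f u n) ⟨
        (h *ₛ u) n + ((x ∙ₛ f) *ₛ u) n     ≈⟨ *ₛ-distribʳ u h (x ∙ₛ f) n ⟨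
        ((h +ₛ x ∙ₛ f) *ₛ u) n             ≈⟨ S.∙-congʳ {u} h+xf≈1 n ⟩
        (1ₛ *ₛ u) n                        ≈⟨ *ₛ-identityˡ u n ⟩
        u n                                ≈⟨ u≈ n ⟩
        v n + x * (f *ₛ u) n               ∎)

      h*D-zero : h *ₛ D x 0 ≈ₛ g
      h*D-zero = solve-h (D-zero x)

      h*D-suc : ∀ ℓ → h *ₛ D x (suc ℓ) ≈ₛ suc ℓ ·ₛ (f *ₛ D x ℓ)
      h*D-suc ℓ = solve-h (D-suc x ℓ)

      -- One factor h turns S_{ℓ+1} into (ℓ + 1) f S_ℓ, and the remaining power of h meets S_ℓ as in
      -- the induction hypothesis. The factorial stays a natural multiple, so the identity holds in
      -- every characteristic.
      h^*D : ∀ ℓ → h ^ₛ suc ℓ *ₛ D x ℓ ≈ₛ (ℓ !) ·ₛ (g *ₛ f ^ₛ ℓ)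
      h^*D zero    n = begin
        (h *ₛ 1ₛ *ₛ D x 0) n   ≈⟨ S.∙-congʳ {D x 0} (S.identityʳ h) n ⟩
        (h *ₛ D x 0) n         ≈⟨ h*D-zero n ⟩
        g n                    ≈⟨ S.identityʳ g n ⟨
        (g *ₛ 1ₛ) n            ≈⟨ ×-homo-1 _ ⟨
        1 ⨯ (g *ₛ 1ₛ) n        ∎
      h^*D (suc ℓ) n = begin
        (h *ₛ H *ₛ D x (suc ℓ)) n
          ≈⟨ S.xy∙z≈y∙xz h H (D x (suc ℓ)) n ⟩
        (H *ₛ (h *ₛ D x (suc ℓ))) n
          ≈⟨ S.∙-congˡ {H} (h*D-suc ℓ) n ⟩
        (H *ₛ suc ℓ ·ₛ (f *ₛ D x ℓ)) n
          ≈⟨ ·ₛ-comm-*ₛ (suc ℓ) H (f *ₛ D x ℓ) n ⟩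
        suc ℓ ⨯ (H *ₛ (f *ₛ D x ℓ)) n
          ≈⟨ ×-congʳ (suc ℓ) (S.x∙yz≈y∙xz H f (D x ℓ) n) ⟩
        suc ℓ ⨯ (f *ₛ (H *ₛ D x ℓ)) n
          ≈⟨ ×-congʳ (suc ℓ) (S.∙-congˡ {f} (h^*D ℓ) n) ⟩
        suc ℓ ⨯ (f *ₛ (ℓ !) ·ₛ (g *ₛ f ^ₛ ℓ)) n
          ≈⟨ ×-congʳ (suc ℓ) (·ₛ-comm-*ₛ (ℓ !) f (g *ₛ f ^ₛ ℓ) n) ⟩
        suc ℓ ⨯ ((ℓ !) ⨯ (f *ₛ (g *ₛ f ^ₛ ℓ)) n)
          ≈⟨ ×-assocˡ _ (suc ℓ) (ℓ !) ⟩
        (suc ℓ !) ⨯ (f *ₛ (g *ₛ f ^ₛ ℓ)) n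
          ≈⟨ ×-congʳ (suc ℓ !) (S.x∙yz≈y∙xz f g (f ^ₛ ℓ) n) ⟩
        (suc ℓ !) ⨯ (g *ₛ f ^ₛ suc ℓ) n
          ∎
        where H = h ^ₛ suc ℓ

      -- The case ℓ = 1 of `h^*D`, freed of the multiple 1! and of the trailing `1ₛ` in `f ^ₛ 1`.
      h²*D-one : h ^ₛ 2 *ₛ D x 1 ≈ₛ g *ₛ f
      h²*D-one n = begin
        (h ^ₛ 2 *ₛ D x 1) n      ≈⟨ h^*D 1 n ⟩
        1 ⨯ (g *ₛ f ^ₛ 1) n      ≈⟨ ×-homo-1 _ ⟩
        (g *ₛ (f *ₛ 1ₛ)) n       ≈⟨ S.∙-congˡ {g} (S.identityʳ f) n ⟩
        (g *ₛ f) n               ∎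

  -- Specialisation to the points 1 and -1

  1-f+f≈1 : ∀ f → (1ₛ -ₛ f) +ₛ 1# ∙ₛ f ≈ₛ 1ₛ
  1-f+f≈1 f n = begin
    1ₛ n - f n + 1# * f n      ≈⟨ +-assoc _ _ _ ⟩
    1ₛ n + (- f n + 1# * f n)  ≈⟨ +-congˡ (+-congˡ (*-identityˡ _)) ⟩
    1ₛ n + (- f n + f n)       ≈⟨ +-congˡ (-‿inverseˡ _) ⟩
    1ₛ n + 0#                  ≈⟨ +-identityʳ _ ⟩
    1ₛ n                       ∎

  1+f-f≈1 : ∀ f → (1ₛ +ₛ f) +ₛ (- 1#) ∙ₛ f ≈ₛ 1ₛ
  1+f-f≈1 f n = begin
    1ₛ n + f n + - 1# * f n    ≈⟨ +-assoc _ _ _ ⟩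
    1ₛ n + (f n + - 1# * f n)  ≈⟨ +-congˡ (+-congˡ (-1*x≈-x _)) ⟩
    1ₛ n + (f n - f n)         ≈⟨ +-congˡ (-‿inverseʳ _) ⟩
    1ₛ n + 0#                  ≈⟨ +-identityʳ _ ⟩
    1ₛ n                       ∎

-- Each differentiation of 1 / (1 - x f) in x contributes a factor f and a natural number, so ℓ! and
-- f^ℓ belong to the numerator. The point -1 enters only through 1 + f, so the first derivative
-- there carries no minus sign.
proposition2p5 :
  ∀ {c ℓ₁ ℓ₂} (K : HeytingField c ℓ₁ ℓ₂) →
  let open HeytingField K
      open Riordan K
  in
  (a b : Poly) (p : ℕ → Poly) →
  (∀ n → p (suc (suc n)) ≈ₚ a *ₚ p (suc n) +ₚ b *ₚ p n) →
  (g f : Series) (R : IsRiordanPair g f) →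
  HasRiordanRepresentation p g f →
  (∀ ℓ n →
    eval (∂^ ℓ (p n)) 1#
      ≈ ((ℓ !) ·ₛ (g *ₛ f ^ₛ ℓ) /ₛ (1ₛ -ₛ f) ^ₛ suc ℓ [ [1-f]^k#0 R (suc ℓ) ]) n)
  × (∀ ℓ n →
    eval (∂^ ℓ (p n)) (- 1#)
      ≈ ((ℓ !) ·ₛ (g *ₛ f ^ₛ ℓ) /ₛ (1ₛ +ₛ f) ^ₛ suc ℓ [ [1+f]^k#0 R (suc ℓ) ]) n)
  × (∀ n → eval (p n) 1# ≈ (g /ₛ (1ₛ -ₛ f) [ 1-f#0 R ]) n)
  × (∀ n → eval (p n) (- 1#) ≈ (g /ₛ (1ₛ +ₛ f) [ 1+f#0 R ]) n)
  × (∀ n → eval (∂ (p n)) 1# ≈ ((g *ₛ f) /ₛ (1ₛ -ₛ f) ^ₛ 2 [ [1-f]^k#0 R 2 ]) n)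
  × (∀ n → eval (∂ (p n)) (- 1#) ≈ ((g *ₛ f) /ₛ (1ₛ +ₛ f) ^ₛ 2 [ [1+f]^k#0 R 2 ]) n)
proposition2p5 K a b p _ g f R p≈gf =
    (λ ℓ → /ₛ-unique _ _ (D 1# ℓ) ([1-f]^k#0 R (suc ℓ)) (At1.h^*D ℓ))
  , (λ ℓ → /ₛ-unique _ _ (D (- 1#) ℓ) ([1+f]^k#0 R (suc ℓ)) (At-1.h^*D ℓ))
  -- Here the denominator is the series itself and not its power with exponent 1, so `h*D-zero` fits
  -- directly.
  , /ₛ-unique g _ (D 1# 0) (1-f#0 R) At1.h*D-zero
  , /ₛ-unique g _ (D (- 1#) 0) (1+f#0 R) At-1.h*D-zero
  , /ₛ-unique _ _ (D 1# 1) ([1-f]^k#0 R 2) At1.h²*D-one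
  , /ₛ-unique _ _ (D (- 1#) 1) ([1+f]^k#0 R 2) At-1.h²*D-one
  where
  open HeytingField K using (1#; -_)
  open Riordan K
  open RiordanProperties K
  open Derivatives g f p p≈gf
  module At1  = Resolvent 1# (1ₛ -ₛ f) (1-f+f≈1 f)
  module At-1 = Resolvent (- 1#) (1ₛ +ₛ f) (1+f-f≈1 f)
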